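{- Let $G=(V,E)$ be a finite undirected graph with $n=|V|\ge 1$ vertices. Let $\overline{\alpha}$ be an integer upper bound of the stability number $\alpha(G)$, let $\underline{s}$ be a positive integer that is a lower bound of the chromatic strength $s(G)$, and let $m$ be an integer upper bound of the maximum number of color classes of size $\overline{\alpha}$ that a proper coloring of $G$ can have. Then the integer partition problem $IPP_{\Sigma M}(n,\overline{\alpha},\underline{s},m)$ is a relaxation of the Minimum Sum Coloring Problem on $G$; that is, its optimal value $\Sigma M(n,\overline{\alpha},\underline{s},m)$ satisfies $$\Sigma M(n,\overline{\alpha},\underline{s},m)\le \Sigma(G).$$
   Context: A (proper) coloring of $G=(V,E)$ with $|V|=n$ is a tuple $\mathbf{V}=(V_1,\dots,V_n)$ of pairwise disjoint, possibly empty subsets of $V$ (color classes) with union $V$, such that no $V_l$ contains both endpoints of an edge, and with classes ordered so that $|V_l|\ge|V_{l+1}|$ for $l=1,\dots,n-1$. Its number of colors is the number of nonempty classes. The Minimum Sum Coloring Problem (MSCP) is to minimize $f_\Sigma(\mathbf{V})=\sum_{l=1}^n l\,|V_l|$ over all such colorings; the minimum value is the chromatic sum $\Sigma(G)$, and a minimizer is an optimal sum coloring. The stability number $\alpha(G)$ is the maximum size of an independent set of $G$. The chromatic strength $s(G)$ is the minimum number of colors used among all optimal sum colorings of $G$. For integers $n,\overline{\alpha},\underline{s},m$, the problem $IPP_{\Sigma M}(n,\overline{\alpha},\underline{s},m)$ is: minimize $f_{\Sigma M}(\mathbf{a})=\sum_{i=1}^n i\,a_i$ over all $\mathbf{a}=(a_i)_{1\le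 i\le n}\in\mathbb{N}^n$ (with $0\in\mathbb{N}$) such that $\sum_{i=1}^n a_i=n$; $a_i\ge a_{i+1}$ for $i=1,\dots,n-1$; $a_i\le\overline{\alpha}$ for all $i$; $|\{i : a_i=\overline{\alpha}\}|\le m$; and $a_{\underline{s}}\ge 1$. Its minimum value is denoted $\Sigma M(n,\overline{\alpha},\underline{s},m)$. -}

module Defs where

open import Level using (0ℓ)
open import Data.Bool.Properties as Bool using ()
open import Data.Fin using (Fin; zero; suc; toℕ)
open import Data.Fin.Properties using (all?)
open import Data.Fin.Subset
  using (Subset; _∈_; _∩_; ⋃; ⊤; ⊥; ⁅_⁆; ∣_∣; Empty)
open import Data.Fin.Subset.Properties
  using (_∈?_; nonempty?; anySubset?; ∣p∣≤n; ∣⁅x⁆∣≡1; x∈⁅x⁆; x∈⁅y⁆⇒x≡y; x∈p∩q⁻;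
         p⊆p∪q; q⊆p∪q; ⊆-antisym; ⊆⊤; ∉⊥)
open import Data.Nat using (ℕ; zero; suc; _*_; _∸_; _≤_; _<_; _≥_)
open import Data.Nat.Induction using (<-wellFounded)
open import Data.Nat.Properties as ℕ using ()
open import Data.Product using (∃; _×_; _,_; proj₁; proj₂)
open import Data.Vec as Vec
  using (Vec; []; _∷_; lookup; map; sum; zipWith; tabulate; count; toList)
open import Data.Vec.Properties using (≡-dec; count≤n)
open import Data.Vec.Relation.Unary.All as All using (All; []; _∷_)
open import Data.Vec.Relation.Unary.All.Properties as All using ()
open import Data.Vec.Relation.Unary.AllPairs using (AllPairs; allPairs?)
open import Data.Vec.Relation.Unary.AllPairs.Properties as AllPairs using ()
open import Data.Vec.Relation.Unary.Linked using (Linked; []; [-]; _∷_; linked?)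
open import Function using (_∘_)
open import Induction.WellFounded using (Acc; acc)
open import Relation.Binary using (Rel; Decidable; Symmetric; Irreflexive)
open import Relation.Binary.PropositionalEquality
  using (_≡_; refl; sym; trans)
open import Relation.Nullary using (¬_; Dec; yes; no)
open import Relation.Nullary.Decidable using (map′; _×-dec_; _→-dec_; ¬?)
import Relation.Unary as U

module _ {A : Set} (P : A → Set) (f : A → ℕ) where

  IsMinimum : ℕ → Set
  IsMinimum v = (∃ λ a → P a × f a ≡ v) × (∀ a → P a → v ≤ f a)

  IsMaximum : ℕ → Set
  IsMaximum v = (∃ λ a → P a × f a ≡ v) × (∀ a → P a → f a ≤ v)

Searchable : Set → Set₁
Searchable A = ∀ {P : A → Set} → U.Decidable P → Dec (∃ P)

module _ {A : Set} (search : Searchable A)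
         {P : A → Set} (P? : U.Decidable P) (f : A → ℕ) where

  minimum : ∃ P → ∃ (IsMinimum P f)
  minimum (a , Pa) = go a Pa (<-wellFounded (f a))
    where
    go : ∀ a → P a → Acc _<_ (f a) → ∃ (IsMinimum P f)
    go a Pa (acc rs) with search (λ b → P? b ×-dec (f b ℕ.<? f a))
    ... | yes (b , Pb , fb<fa) = go b Pb (rs fb<fa)
    ... | no  ∄b = f a , (a , Pa , refl) , λ b Pb → ℕ.≮⇒≥ λ fb<fa → ∄b (b , Pb , fb<fa)

  maximum : (N : ℕ) → (∀ a → f a ≤ N) → ∃ P → ∃ (IsMaximum P f)
  maximum N f≤N (a , Pa) = go a Pa (<-wellFounded (N ∸ f a))
    where
    go : ∀ a → P a → Acc _<_ (N ∸ f a) → ∃ (IsMaximum P f)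
    go a Pa (acc rs) with search (λ b → P? b ×-dec (f a ℕ.<? f b))
    ... | yes (b , Pb , fa<fb) = go b Pb (rs (ℕ.∸-monoʳ-< fa<fb (f≤N b)))
    ... | no  ∄b = f a , (a , Pa , refl) , λ b Pb → ℕ.≮⇒≥ λ fa<fb → ∄b (b , Pb , fa<fb)

anyVec? : ∀ {A} → Searchable A → ∀ n → Searchable (Vec A n)
anyVec? search zero    P? = map′ ([] ,_) (λ { ([] , p) → p }) (P? [])
anyVec? search (suc n) P? =
  map′ (λ (x , xs , p) → x ∷ xs , p) (λ { (x ∷ xs , p) → x , xs , p })
       (search λ x → anyVec? search n λ xs → P? (x ∷ xs))

record Graph (n : ℕ) : Set₁ where
  field
    Adj        : Rel (Fin n) 0ℓ
    adj?       : Decidable Adj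
    adj-sym    : Symmetric Adj
    adj-irrefl : Irreflexive _≡_ Adj

Disjoint : ∀ {n} → Rel (Subset n) 0ℓ
Disjoint S T = Empty (S ∩ T)

disjoint? : ∀ {n} → Decidable (Disjoint {n})
disjoint? S T = ¬? (nonempty? (S ∩ T))

-- The value of ∑ i·aᵢ, where i is counted from 1.
weightedSum : ∀ {n} → Vec ℕ n → ℕ
weightedSum a = sum (zipWith _*_ (tabulate (suc ∘ toℕ)) a)

colorSum : ∀ {n} → Vec (Subset n) n → ℕ
colorSum V = weightedSum (map ∣_∣ V)

numColors : ∀ {n} → Vec (Subset n) n → ℕ
numColors V = count nonempty? V

numClassesOfSize : ∀ {n} → ℕ → Vec (Subset n) n → ℕ
numClassesOfSize k V = count (λ S → ∣ S ∣ ℕ.≟ k) V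

module _ {n : ℕ} (G : Graph n) where
  open Graph G

  Stable : Subset n → Set
  Stable S = ∀ u v → u ∈ S → v ∈ S → ¬ Adj u v

  stable? : U.Decidable Stable
  stable? S = all? λ u → all? λ v → (u ∈? S) →-dec ((v ∈? S) →-dec ¬? (adj? u v))

  record IsColoring (V : Vec (Subset n) n) : Set where
    constructor mkColoring
    field
      disjoint : AllPairs Disjoint V
      covers   : ⋃ (toList V) ≡ ⊤
      stable   : All Stable V
      ordered  : Linked _≥_ (map ∣_∣ V)

  isColoring? : U.Decidable IsColoring
  isColoring? V =
    map′ (λ (d , c , s , o) → mkColoring d c s o)
         (λ (mkColoring d c s o) → d , c , s , o)
         (allPairs? disjoint? V ×-dec ≡-dec Bool._≟_ _ _ ×-dec
          All.all? stable? V ×-dec linked? ℕ._≥?_ _)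

  singletons : Vec (Subset n) n
  singletons = tabulate ⁅_⁆

  singletons-isColoring : IsColoring singletons
  singletons-isColoring = mkColoring
    (AllPairs.tabulate⁺ λ {i} {j} i≢j (x , x∈) →
      let x∈i , x∈j = x∈p∩q⁻ ⁅ i ⁆ ⁅ j ⁆ x∈
      in i≢j (trans (sym (x∈⁅y⁆⇒x≡y i x∈i)) (x∈⁅y⁆⇒x≡y j x∈j)))
    (⊆-antisym ⊆⊤ λ {x} _ → ∈⋃ ⁅_⁆ x (x∈⁅x⁆ x))
    (All.tabulate⁺ λ i u v u∈ v∈ →
      adj-irrefl (trans (x∈⁅y⁆⇒x≡y i u∈) (sym (x∈⁅y⁆⇒x≡y i v∈))))
    (descending ⁅_⁆ ∣⁅x⁆∣≡1)
    where
    ∈⋃ : ∀ {k x} (f : Fin k → Subset n) i → x ∈ f i → x ∈ ⋃ (toList (tabulate f))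
    ∈⋃ f zero    x∈ = p⊆p∪q _ x∈
    ∈⋃ f (suc i) x∈ = q⊆p∪q (f zero) _ (∈⋃ (f ∘ suc) i x∈)

    descending : ∀ {k} (f : Fin k → Subset n) → (∀ i → ∣ f i ∣ ≡ 1) →
                 Linked _≥_ (map ∣_∣ (tabulate f))
    descending {zero}        f f≡1 = []
    descending {suc zero}    f f≡1 = [-]
    descending {suc (suc k)} f f≡1 =
      ℕ.≤-reflexive (trans (f≡1 (suc zero)) (sym (f≡1 zero))) ∷
      descending (f ∘ suc) (f≡1 ∘ suc)

  anyClasses? : Searchable (Vec (Subset n) n)
  anyClasses? = anyVec? anySubset? n

  stabilityNumber-∃ : ∃ (IsMaximum Stable ∣_∣)
  stabilityNumber-∃ =
    maximum anySubset? stable? ∣_∣ n ∣p∣≤n (⊥ , λ u v u∈⊥ _ _ → ∉⊥ u∈⊥)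

  stabilityNumber : ℕ
  stabilityNumber = proj₁ stabilityNumber-∃

  chromaticSum-∃ : ∃ (IsMinimum IsColoring colorSum)
  chromaticSum-∃ =
    minimum anyClasses? isColoring? colorSum (singletons , singletons-isColoring)

  chromaticSum : ℕ
  chromaticSum = proj₁ chromaticSum-∃

  IsOptimalColoring : Vec (Subset n) n → Set
  IsOptimalColoring V = IsColoring V × colorSum V ≡ chromaticSum

  chromaticStrength-∃ : ∃ (IsMinimum IsOptimalColoring numColors)
  chromaticStrength-∃ =
    minimum anyClasses? (λ V → isColoring? V ×-dec (colorSum V ℕ.≟ chromaticSum))
            numColors (proj₁ (proj₂ chromaticSum-∃))

  chromaticStrength : ℕ
  chromaticStrength = proj₁ chromaticStrength-∃

  maxClassesOfSize-∃ : ∀ k → ∃ (IsMaximum IsColoring (numClassesOfSize k))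
  maxClassesOfSize-∃ k =
    maximum anyClasses? isColoring? (numClassesOfSize k) n
            (count≤n (λ S → ∣ S ∣ ℕ.≟ k)) (singletons , singletons-isColoring)

  maxClassesOfSize : ℕ → ℕ
  maxClassesOfSize k = proj₁ (maxClassesOfSize-∃ k)

record IsFeasible (n ᾱ s m : ℕ) (a : Vec ℕ n) : Set where
  field
    total   : sum a ≡ n
    ordered : Linked _≥_ a
    bounded : All (_≤ ᾱ) a
    atMostM : count (ℕ._≟ ᾱ) a ≤ m
    -- aₛ ≥ 1 for the 1-based index s; it fails when s is not in {1, …, n}.
    used    : ∃ λ (i : Fin n) → suc (toℕ i) ≡ s × 1 ≤ lookup a i

-- A relation, since the problem may be infeasible for some parameters.
IsΣM : (n ᾱ s m : ℕ) → ℕ → Set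
IsΣM n ᾱ s m = IsMinimum (IsFeasible n ᾱ s m) weightedSum

{-# OPTIONS --safe #-}

-- The class sizes of an optimal sum coloring with the fewest colors form a
-- feasible vector of objective value Σ(G): the classes partition the vertices,
-- each is stable, and since the sizes descend, the first s(G) of them are the
-- nonempty ones. The minimum is attained because feasible vectors have entries
-- in {0, …, ᾱ}, so there are only finitely many of them.
module Submission where

open import Defs
open import Data.Bool using (true; false)
open import Data.Fin using (Fin; zero; suc; toℕ; fromℕ<)
open import Data.Fin.Properties using (any?; toℕ-fromℕ<)
open import Data.Fin.Subset using (Subset; _∪_; ⋃; ∣_∣; Nonempty)
open import Data.Fin.Subset.Properties
  using (nonempty?; drop-∷-Empty; Empty-unique; ∣⊥∣≡0; ∣⊤∣≡n; ∉⊥;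
         x∈p∩q⁺; x∈p∩q⁻; x∈p∪q⁻; x∈p⇒∣p-x∣<∣p∣)
open import Data.Nat using (ℕ; suc; _+_; _≤_; _<_; _≥_; s≤s; s<s⁻¹)
open import Data.Nat.Properties as ℕ using ()
open import Data.Product using (∃; ∃-syntax; _×_; _,_; proj₁; proj₂)
open import Data.Sum using (inj₁; inj₂)
open import Data.Vec using (Vec; []; _∷_; here; lookup; map; sum; count; toList)
open import Data.Vec.Properties using (count≤n; lookup-map)
open import Data.Vec.Relation.Unary.All as All using (All; []; _∷_)
open import Data.Vec.Relation.Unary.All.Properties as All using ()
open import Data.Vec.Relation.Unary.AllPairs using (AllPairs; []; _∷_)
open import Data.Vec.Relation.Unary.Linked using (Linked; [-]; _∷_; linked?)
open import Data.Vec.Relation.Unary.Linked.Properties as Linked using ()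
open import Function using (_∘_)
open import Relation.Binary.PropositionalEquality
  using (_≡_; refl; sym; trans; cong; cong₂; subst)
open import Relation.Nullary using (yes; no; does; contradiction)
open import Relation.Nullary.Decidable using (map′; _×-dec_)
open import Relation.Unary using (Decidable)

private
  variable
    n k : ℕ
    A B : Set

count-map : {P : B → Set} (P? : Decidable P) (f : A → B) (xs : Vec A n) →
            count P? (map f xs) ≡ count (P? ∘ f) xs
count-map P? f [] = refl
count-map P? f (x ∷ xs) with does (P? (f x))
... | true  = cong suc (count-map P? f xs)
... | false = count-map P? f xs

-- Since `resp` carries `P` backwards along the chain, the entries satisfying `P` form an initial
-- segment, whose length is the count.
<count⇒lookup : {R : A → A → Set} {P : A → Set} (P? : Decidable P) →
                (∀ {x y} → R x y → P y → P x) →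
                {xs : Vec A n} → Linked R xs →
                ∀ i → toℕ i < count P? xs → P (lookup xs i)
<count⇒lookup P? resp {x ∷ _} [-] zero i< with P? x
... | yes Px = Px
... | no  _  = contradiction i< ℕ.n≮0
<count⇒lookup P? resp {x ∷ _ ∷ _} (Rxy ∷ Rys) zero i< with P? x
... | yes Px = Px
-- If the head fails, the whole positive count comes from the tail, so the tail's first entry
-- satisfies `P`, and `resp` hands `P` back to `x`.
... | no  _  = resp Rxy (<count⇒lookup P? resp Rys zero i<)
<count⇒lookup P? resp {x ∷ _ ∷ _} (_ ∷ Rys) (suc i) i< with P? x
... | yes _ = <count⇒lookup P? resp Rys i (s<s⁻¹ i<)
... | no  _ = <count⇒lookup P? resp Rys i (ℕ.<⇒≤ i<)

Nonempty⇒∣p∣>0 : {p : Subset n} → Nonempty p → 0 < ∣ p ∣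
Nonempty⇒∣p∣>0 (_ , x∈p) = ℕ.m<n⇒0<n (x∈p⇒∣p-x∣<∣p∣ x∈p)

∣p∣>0⇒Nonempty : {p : Subset n} → 0 < ∣ p ∣ → Nonempty p
∣p∣>0⇒Nonempty {n} {p} ∣p∣>0 with nonempty? p
... | yes ne = ne
... | no  ¬ne = contradiction (trans (cong ∣_∣ (Empty-unique ¬ne)) (∣⊥∣≡0 n)) (ℕ.>⇒≢ ∣p∣>0)

∣p∪q∣≡∣p∣+∣q∣ : (p q : Subset n) → Disjoint p q → ∣ p ∪ q ∣ ≡ ∣ p ∣ + ∣ q ∣
∣p∪q∣≡∣p∣+∣q∣ []          []          _ = refl
∣p∪q∣≡∣p∣+∣q∣ (true  ∷ p) (true  ∷ q) d = contradiction (zero , here) d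
∣p∪q∣≡∣p∣+∣q∣ (true  ∷ p) (false ∷ q) d = cong suc (∣p∪q∣≡∣p∣+∣q∣ p q (drop-∷-Empty d))
∣p∪q∣≡∣p∣+∣q∣ (false ∷ p) (true  ∷ q) d =
  trans (cong suc (∣p∪q∣≡∣p∣+∣q∣ p q (drop-∷-Empty d))) (sym (ℕ.+-suc ∣ p ∣ ∣ q ∣))
∣p∪q∣≡∣p∣+∣q∣ (false ∷ p) (false ∷ q) d = ∣p∪q∣≡∣p∣+∣q∣ p q (drop-∷-Empty d)

Disjoint-⋃ : (p : Subset n) (ps : Vec (Subset n) k) →
             All (Disjoint p) ps → Disjoint p (⋃ (toList ps))
Disjoint-⋃ p [] [] (x , x∈) = ∉⊥ (proj₂ (x∈p∩q⁻ p _ x∈))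
Disjoint-⋃ p (q ∷ qs) (d ∷ ds) (x , x∈) with x∈p∩q⁻ p _ x∈
... | x∈p , x∈⋃ with x∈p∪q⁻ q _ x∈⋃
... | inj₁ x∈q  = d (x , x∈p∩q⁺ (x∈p , x∈q))
... | inj₂ x∈qs = Disjoint-⋃ p qs ds (x , x∈p∩q⁺ (x∈p , x∈qs))

-- Combined with `covers`, this makes the class sizes of a coloring sum to `n`.
∣⋃∣≡sum : (ps : Vec (Subset n) k) → AllPairs Disjoint ps →
          ∣ ⋃ (toList ps) ∣ ≡ sum (map ∣_∣ ps)
∣⋃∣≡sum {n} [] [] = ∣⊥∣≡0 n
∣⋃∣≡sum (p ∷ ps) (d ∷ ds) =
  trans (∣p∪q∣≡∣p∣+∣q∣ p _ (Disjoint-⋃ p ps d)) (cong (∣ p ∣ +_) (∣⋃∣≡sum ps ds))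

isFeasible? : ∀ n ᾱ s m → Decidable (IsFeasible n ᾱ s m)
isFeasible? n ᾱ s m a =
  map′ (λ (t , o , b , c , u) →
          record { total = t ; ordered = o ; bounded = b ; atMostM = c ; used = u })
       (λ F → let open IsFeasible F in total , ordered , bounded , atMostM , used)
       (sum a ℕ.≟ n ×-dec linked? ℕ._≥?_ a ×-dec All.all? (ℕ._≤? ᾱ) a ×-dec
        count (ℕ._≟ ᾱ) a ℕ.≤? m ×-dec
        any? (λ i → suc (toℕ i) ℕ.≟ s ×-dec 1 ℕ.≤? lookup a i))

-- `Vec ℕ n` cannot be searched exhaustively, but `Vec (Fin (suc k)) n` can; its image under
-- `map toℕ` contains every vector bounded by `k`.
bounded⇒map-toℕ : {a : Vec ℕ n} → All (_≤ k) a →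
                  ∃ λ (b : Vec (Fin (suc k)) n) → map toℕ b ≡ a
bounded⇒map-toℕ [] = [] , refl
bounded⇒map-toℕ (x≤k ∷ xs≤k) with bounded⇒map-toℕ xs≤k
... | b , eq = fromℕ< (s≤s x≤k) ∷ b , cong₂ _∷_ (toℕ-fromℕ< (s≤s x≤k)) eq

-- Pulling a problem back along `g` keeps its minimum as soon as every point satisfying `P` has a
-- preimage; `g` need not hit anything else.
IsMinimum-cover : {P : A → Set} {f : A → ℕ} (g : B → A) →
                  (∀ a → P a → ∃ λ b → g b ≡ a) →
                  ∀ {v} → IsMinimum (P ∘ g) (f ∘ g) v → IsMinimum P f v
IsMinimum-cover {P = P} {f} g cover {v} ((b , Pgb , eq) , least) =
  (g b , Pgb , eq) , λ a Pa → bound a Pa (cover a Pa)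
  where
  bound : ∀ a → P a → (∃ λ b → g b ≡ a) → v ≤ f a
  bound _ Pgb (b , refl) = least b Pgb

feasible⇒ΣM : ∀ {n ᾱ s m} → ∃ (IsFeasible n ᾱ s m) → ∃ (IsΣM n ᾱ s m)
feasible⇒ΣM {n} {ᾱ} {s} {m} (a , Fa) =
  let v , isMin = minimum (anyVec? any? n) (λ b → isFeasible? n ᾱ s m (map toℕ b))
                          (weightedSum ∘ map toℕ) feasible
  in v , IsMinimum-cover (map toℕ) cover isMin
  where
  cover : ∀ a → IsFeasible n ᾱ s m a → ∃ λ (b : Vec (Fin (suc ᾱ)) n) → map toℕ b ≡ a
  cover a = bounded⇒map-toℕ ∘ IsFeasible.bounded

  feasible : ∃ λ (b : Vec (Fin (suc ᾱ)) n) → IsFeasible n ᾱ s m (map toℕ b)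
  feasible =
    let b , eq = cover a Fa in b , subst (IsFeasible n ᾱ s m) (sym eq) Fa

-- The constraints come one by one from the coloring: stable classes obey the bound `ᾱ`, the count
-- of classes of size `ᾱ` is at most its maximum, and having at least `s` colors makes the `s`-th
-- class nonempty.
coloring⇒feasible : (G : Graph n) {ᾱ s m : ℕ} {V : Vec (Subset n) n} →
                    IsColoring G V → stabilityNumber G ≤ ᾱ →
                    1 ≤ s → s ≤ numColors V → maxClassesOfSize G ᾱ ≤ m →
                    IsFeasible n ᾱ s m (map ∣_∣ V)
coloring⇒feasible {n} G {ᾱ} {suc k} {m} {V} C α≤ᾱ _ s≤colors max≤m = record
  { total   = trans (sym (∣⋃∣≡sum V disjoint)) (trans (cong ∣_∣ covers) (∣⊤∣≡n n))
  ; ordered = ordered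
  ; bounded = All.map⁺ (All.map (λ {S} stableS →
      ℕ.≤-trans (proj₂ (proj₂ (stabilityNumber-∃ G)) S stableS) α≤ᾱ) stable)
  ; atMostM = ℕ.≤-trans
      (ℕ.≤-reflexive (count-map (ℕ._≟ ᾱ) ∣_∣ V))
      (ℕ.≤-trans (proj₂ (proj₂ (maxClassesOfSize-∃ G ᾱ)) V C) max≤m)
  ; used    = i , cong suc toℕi≡k , ℕ.≤-trans
      -- Ordering by size puts the nonempty classes first, and position `k` is among the first
      -- `numColors V`.
      (Nonempty⇒∣p∣>0 (<count⇒lookup nonempty? larger-Nonempty (Linked.map⁻ ordered) i
        (subst (_< numColors V) (sym toℕi≡k) s≤colors)))
      (ℕ.≤-reflexive (sym (lookup-map i ∣_∣ V)))
  }
  where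
  open IsColoring C

  -- The index `s` is `suc k` counted from 1, hence `k` in `Fin n`; it is in range because `s` of
  -- the `n` classes are nonempty.
  k<n : k < n
  k<n = ℕ.≤-trans s≤colors (count≤n nonempty? V)

  i : Fin n
  i = fromℕ< k<n

  toℕi≡k : toℕ i ≡ k
  toℕi≡k = toℕ-fromℕ< k<n

  larger-Nonempty : {p q : Subset n} → ∣ p ∣ ≥ ∣ q ∣ → Nonempty q → Nonempty p
  larger-Nonempty ∣p∣≥∣q∣ ne = ∣p∣>0⇒Nonempty (ℕ.≤-trans (Nonempty⇒∣p∣>0 ne) ∣p∣≥∣q∣)

theorem1 : (n : ℕ) → 1 ≤ n → (G : Graph n) → (ᾱ s m : ℕ) →
    stabilityNumber G ≤ ᾱ →
    1 ≤ s → s ≤ chromaticStrength G →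
    maxClassesOfSize G ᾱ ≤ m →
    ∃[ μ ] (IsΣM n ᾱ s m μ × μ ≤ chromaticSum G)
theorem1 n _ G ᾱ s m α≤ᾱ 1≤s s≤strength max≤m =
  let (V , (C , optimal) , colors≡strength) , _ = proj₂ (chromaticStrength-∃ G)
      F = coloring⇒feasible G C α≤ᾱ 1≤s
            (ℕ.≤-trans s≤strength (ℕ.≤-reflexive (sym colors≡strength))) max≤m
      μ , isΣM = feasible⇒ΣM (map ∣_∣ V , F)
  -- `weightedSum (map ∣_∣ V)` is `colorSum V` by definition, so `optimal` identifies the objective
  -- value with the chromatic sum.
  in μ , isΣM , ℕ.≤-trans (proj₂ isΣM (map ∣_∣ V) F) (ℕ.≤-reflexive optimal)
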